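{- Let $L$ be one of $IvFDE_{T4}$, $IvFDE_{T45}$, $IvFDE_{TB}$, $IvFDE_{T4B}$, $IvFDE_{T5}$. (1) For every set of formulas $\Gamma\cup\{\varphi\}$ over $\Sigma_4=\{\land,\lor,\to,\neg\}$: $\Gamma\vdash_L\varphi$ iff $\Gamma\vdash_{\mathcal{IDM}4}\varphi$. (2) For every set of formulas $\Gamma\cup\{\varphi\}$ over $\Sigma_m=\{\to,\sim,\square\}$: (2.1) $\Gamma\vdash_{IvFDE_{T4}}\varphi$ iff $\Gamma\vdash_{T4m}\varphi$; (2.2) $\Gamma\vdash_{IvFDE_{T45}}\varphi$ iff $\Gamma\vdash_{T45m}\varphi$; (2.3) $\Gamma\vdash_{IvFDE_{TB}}\varphi$ iff $\Gamma\vdash_{TBm}\varphi$; (2.4) $\Gamma\vdash_{IvFDE_{T4B}}\varphi$ iff $\Gamma\vdash_{T4Bm}\varphi$; (2.5) $\Gamma\vdash_{IvFDE_{T5}}\varphi$ iff $\Gamma\vdash_{T5m}\varphi$.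
   Context: Formulas are built from a countable set of propositional variables. All calculi below have modus ponens as their only rule. $\mathcal{IDM}4$ is the calculus over $\Sigma_4$ in which $\alpha\leftrightarrow\beta$ is $(\alpha\to\beta)\land(\beta\to\alpha)$, with axiom schemas: - $\varphi\to(\psi\to\varphi)$; - $(\varphi\to(\psi\to\gamma))\to((\varphi\to\psi)\to(\varphi\to\gamma))$; - $\varphi\to(\psi\to(\varphi\land\psi))$; - $(\varphi\land\psi)\to\varphi$; - $(\varphi\land\psi)\to\psi$; - $\varphi\to(\varphi\lor\psi)$; - $\psi\to(\varphi\lor\psi)$; - $(\varphi\to\gamma)\to((\psi\to\gamma)\to((\varphi\lor\psi)\to\gamma))$; - $\neg\neg\varphi\leftrightarrow\varphi$; - $\neg(\varphi\lor\psi)\leftrightarrow(\neg\varphi\land\neg\psi)$; - $\neg(\varphi\land\psi)\leftrightarrow(\neg\varphi\lor\neg\psi)$; - $\neg(\varphi\to\psi)\leftrightarrow(\varphi\land\neg\psi)$; - $\varphi\lor(\varphi\to\psi)$. $Tm$ is the calculus over $\Sigma_m$ in which $\alpha\lor\beta:=\sim\alpha\to\beta$, $\alpha\land\beta:=\sim(\alpha\to\sim\beta)$ and $\alpha\leftrightarrow\beta:=\sim((\alpha\to\beta)\to\sim(\beta\to\alpha))$. Its axiom schemas are: - $\varphi\to(\psi\to\varphi)$; - $(\varphi\to(\psi\to\gamma))\to((\varphi\to\psi)\to(\varphi\to\gamma))$; - $(\sim\psi\to\sim\varphi)\to((\sim\psi\to\varphi)\to\psi)$; - (K) $\square(\varphi\to\psi)\to(\square\varphi\to\square\psi)$;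 - (K1) $\square(\varphi\to\psi)\to(\square\sim\psi\to\square\sim\varphi)$; - (K2) $\square\sim(\varphi\to\psi)\leftrightarrow(\square\varphi\land\square\sim\psi)$; - (M1) $(\square\sim\varphi\lor\square\psi)\to\square(\varphi\to\psi)$; - (T) $\square\varphi\to\varphi$; - (DN1) $\square\varphi\leftrightarrow\square\sim\sim\varphi$. $IvFDE_T$ is the calculus over $\Sigma=\{\land,\lor,\to,\neg,\sim,\square\}$, with $\land,\lor$ primitive and $\leftrightarrow$ read as in $\mathcal{IDM}4$. Its axioms are all the axioms of $\mathcal{IDM}4$ and of $Tm$ (read in this signature), plus: - $\square(\varphi\land\psi)\leftrightarrow(\square\varphi\land\square\psi)$; - $\square\sim(\varphi\lor\psi)\leftrightarrow\square(\sim\varphi\land\sim\psi)$; - $(\square\sim\varphi\lor\square\sim\psi)\to\square\sim(\varphi\land\psi)$; - $(\square\varphi\lor\square\psi)\to\square(\varphi\lor\psi)$; - $\square\varphi\leftrightarrow\square\sim\neg\varphi$; - $\square\sim\varphi\leftrightarrow\square\sim\neg\neg\varphi$; - $\square\sim(\varphi\land\psi)\to(\square\varphi\to\square\sim\psi)$; - $\square\sim(\varphi\land\psi)\to(\square\psi\to\square\sim\varphi)$; - $\square(\varphi\lor\psi)\to(\square\sim\varphi\to\square\psi)$; - $\square(\varphi\lor\psi)\to(\square\sim\psi\to\square\varphi)$. Modal axiom schemas: - (4) $\square\varphi\to\square\square\varphi$; - (5) $\sim\square\sim\square\varphi\to\square\varphi$; - (B) $\sim\square\sim\square\varphi\to\varphi$.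 The calculi $T4m$, $T45m$, $TBm$, $T4Bm$, $T5m$ are $Tm$ plus, respectively, (4); (4) and (5); (B); (B) and (4); (5). The calculi $IvFDE_{T4}$, $IvFDE_{T45}$, $IvFDE_{TB}$, $IvFDE_{T4B}$, $IvFDE_{T5}$ are $IvFDE_T$ plus the same respective axioms. -}

module Defs where

open import Data.Nat using (ℕ)
open import Data.Product using (Σ; _×_)
open import Data.Unit using (⊤)
open import Data.Empty using (⊥)
open import Relation.Binary.PropositionalEquality using (_≡_)

data Fm : Set where
  var  : ℕ → Fm
  _∧_  : Fm → Fm → Fm
  _∨_  : Fm → Fm → Fm
  _⇒_  : Fm → Fm → Fm
  ¬_   : Fm → Fm
  ∼_   : Fm → Fm
  □_   : Fm → Fm

data Fm4 : Set where
  var4 : ℕ → Fm4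
  and4 : Fm4 → Fm4 → Fm4
  or4  : Fm4 → Fm4 → Fm4
  imp4 : Fm4 → Fm4 → Fm4
  neg4 : Fm4 → Fm4

data FmM : Set where
  varM : ℕ → FmM
  impM : FmM → FmM → FmM
  tnM  : FmM → FmM
  boxM : FmM → FmM

ι4 : Fm4 → Fm
ι4 (var4 n)   = var n
ι4 (and4 a b) = ι4 a ∧ ι4 b
ι4 (or4 a b)  = ι4 a ∨ ι4 b
ι4 (imp4 a b) = ι4 a ⇒ ι4 b
ι4 (neg4 a)   = ¬ ι4 a

ιm : FmM → Fm
ιm (varM n)   = var n
ιm (impM a b) = ιm a ⇒ ιm b
ιm (tnM a)    = ∼ ιm a
ιm (boxM a)   = □ ιm a

Img : {A B : Set} → (A → B) → (A → Set) → (B → Set)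
Img {A} f Γ b = Σ A (λ a → Γ a × f a ≡ b)

data Deriv {F : Set} (imp : F → F → F) (Ax : F → Set) (Γ : F → Set) : F → Set where
  hyp : ∀ {φ} → Γ φ → Deriv imp Ax Γ φ
  ax  : ∀ {φ} → Ax φ → Deriv imp Ax Γ φ
  mp  : ∀ {φ ψ} → Deriv imp Ax Γ φ → Deriv imp Ax Γ (imp φ ψ) → Deriv imp Ax Γ ψ

-- Connective interpretations, so that the same schemas can be "read"
-- in different signatures.

record IDMSig (F : Set) : Set where
  field
    imp : F → F → F
    and : F → F → F
    or  : F → F → F
    neg : F → F
  iff : F → F → F
  iff a b = and (imp a b) (imp b a)

module _ {F : Set} (S : IDMSig F) where
  open IDMSig S
  data IDMAx : F → Set where
    a1  : ∀ φ ψ → IDMAx (imp φ (imp ψ φ))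
    a2  : ∀ φ ψ γ → IDMAx (imp (imp φ (imp ψ γ)) (imp (imp φ ψ) (imp φ γ)))
    a3  : ∀ φ ψ → IDMAx (imp φ (imp ψ (and φ ψ)))
    a4  : ∀ φ ψ → IDMAx (imp (and φ ψ) φ)
    a5  : ∀ φ ψ → IDMAx (imp (and φ ψ) ψ)
    a6  : ∀ φ ψ → IDMAx (imp φ (or φ ψ))
    a7  : ∀ φ ψ → IDMAx (imp ψ (or φ ψ))
    a8  : ∀ φ ψ γ → IDMAx (imp (imp φ γ) (imp (imp ψ γ) (imp (or φ ψ) γ)))
    a9  : ∀ φ → IDMAx (iff (neg (neg φ)) φ)
    a10 : ∀ φ ψ → IDMAx (iff (neg (or φ ψ)) (and (neg φ) (neg ψ)))
    a11 : ∀ φ ψ → IDMAx (iff (neg (and φ ψ)) (or (neg φ) (neg ψ)))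
    a12 : ∀ φ ψ → IDMAx (iff (neg (imp φ ψ)) (and φ (neg ψ)))
    a13 : ∀ φ ψ → IDMAx (or φ (imp φ ψ))

record TmSig (F : Set) : Set where
  field
    imp : F → F → F
    tn  : F → F
    box : F → F
    and : F → F → F
    or  : F → F → F
  iff : F → F → F
  iff a b = and (imp a b) (imp b a)

module _ {F : Set} (S : TmSig F) where
  open TmSig S
  data TmAx : F → Set where
    t1  : ∀ φ ψ → TmAx (imp φ (imp ψ φ))
    t2  : ∀ φ ψ γ → TmAx (imp (imp φ (imp ψ γ)) (imp (imp φ ψ) (imp φ γ)))
    t3  : ∀ φ ψ → TmAx (imp (imp (tn ψ) (tn φ)) (imp (imp (tn ψ) φ) ψ))
    K   : ∀ φ ψ → TmAx (imp (box (imp φ ψ)) (imp (box φ) (box ψ)))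
    K1  : ∀ φ ψ → TmAx (imp (box (imp φ ψ)) (imp (box (tn ψ)) (box (tn φ))))
    K2  : ∀ φ ψ → TmAx (iff (box (tn (imp φ ψ))) (and (box φ) (box (tn ψ))))
    M1  : ∀ φ ψ → TmAx (imp (or (box (tn φ)) (box ψ)) (box (imp φ ψ)))
    T   : ∀ φ → TmAx (imp (box φ) φ)
    DN1 : ∀ φ → TmAx (iff (box φ) (box (tn (tn φ))))

data Ext : Set where
  T4 T45 TB T4B T5 : Ext

Has4 Has5 HasB : Ext → Set
Has4 T4  = ⊤
Has4 T45 = ⊤
Has4 TB  = ⊥
Has4 T4B = ⊤
Has4 T5  = ⊥
Has5 T4  = ⊥
Has5 T45 = ⊤
Has5 TB  = ⊥
Has5 T4B = ⊥
Has5 T5  = ⊤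
HasB T4  = ⊥
HasB T45 = ⊥
HasB TB  = ⊤
HasB T4B = ⊤
HasB T5  = ⊥

module _ {F : Set} (S : TmSig F) where
  open TmSig S
  data ModalAx (e : Ext) : F → Set where
    ax4 : Has4 e → ∀ φ → ModalAx e (imp (box φ) (box (box φ)))
    ax5 : Has5 e → ∀ φ → ModalAx e (imp (tn (box (tn (box φ)))) (box φ))
    axB : HasB e → ∀ φ → ModalAx e (imp (tn (box (tn (box φ)))) φ)

S4 : IDMSig Fm4
S4 = record { imp = imp4 ; and = and4 ; or = or4 ; neg = neg4 }

-- Σm with ∨, ∧ defined as in Tm
Sm : TmSig FmM
Sm = record { imp = impM ; tn = tnM ; box = boxM
            ; and = λ a b → tnM (impM a (tnM b))
            ; or  = λ a b → impM (tnM a) b }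

SΣ4 : IDMSig Fm
SΣ4 = record { imp = _⇒_ ; and = _∧_ ; or = _∨_ ; neg = ¬_ }

SΣm : TmSig Fm
SΣm = record { imp = _⇒_ ; tn = ∼_ ; box = □_ ; and = _∧_ ; or = _∨_ }

_↔_ : Fm → Fm → Fm
a ↔ b = (a ⇒ b) ∧ (b ⇒ a)

data IvAx : Fm → Set where
  i1  : ∀ φ ψ → IvAx ((□ (φ ∧ ψ)) ↔ ((□ φ) ∧ (□ ψ)))
  i2  : ∀ φ ψ → IvAx ((□ (∼ (φ ∨ ψ))) ↔ (□ ((∼ φ) ∧ (∼ ψ))))
  i3  : ∀ φ ψ → IvAx (((□ (∼ φ)) ∨ (□ (∼ ψ))) ⇒ (□ (∼ (φ ∧ ψ))))
  i4  : ∀ φ ψ → IvAx (((□ φ) ∨ (□ ψ)) ⇒ (□ (φ ∨ ψ)))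
  i5  : ∀ φ → IvAx ((□ φ) ↔ (□ (∼ (¬ φ))))
  i6  : ∀ φ → IvAx ((□ (∼ φ)) ↔ (□ (∼ (¬ (¬ φ)))))
  i7  : ∀ φ ψ → IvAx ((□ (∼ (φ ∧ ψ))) ⇒ ((□ φ) ⇒ (□ (∼ ψ))))
  i8  : ∀ φ ψ → IvAx ((□ (∼ (φ ∧ ψ))) ⇒ ((□ ψ) ⇒ (□ (∼ φ))))
  i9  : ∀ φ ψ → IvAx ((□ (φ ∨ ψ)) ⇒ ((□ (∼ φ)) ⇒ (□ ψ)))
  i10 : ∀ φ ψ → IvAx ((□ (φ ∨ ψ)) ⇒ ((□ (∼ ψ)) ⇒ (□ φ)))

_⊢IDM4_ : (Fm4 → Set) → Fm4 → Set
Γ ⊢IDM4 φ = Deriv imp4 (IDMAx S4) Γ φ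

data TmLAx (e : Ext) : FmM → Set where
  base  : ∀ {φ} → TmAx Sm φ → TmLAx e φ
  modal : ∀ {φ} → ModalAx Sm e φ → TmLAx e φ

_⊢Tm[_]_ : (FmM → Set) → Ext → FmM → Set
Γ ⊢Tm[ e ] φ = Deriv impM (TmLAx e) Γ φ

data IvFDEAx (e : Ext) : Fm → Set where
  idm   : ∀ {φ} → IDMAx SΣ4 φ → IvFDEAx e φ
  tm    : ∀ {φ} → TmAx SΣm φ → IvFDEAx e φ
  iv    : ∀ {φ} → IvAx φ → IvFDEAx e φ
  modal : ∀ {φ} → ModalAx SΣm e φ → IvFDEAx e φ

_⊢Iv[_]_ : (Fm → Set) → Ext → Fm → Set
Γ ⊢Iv[ e ] φ = Deriv _⇒_ (IvFDEAx e) Γ φ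

{-# OPTIONS --safe #-}

-- Over Σm, conservativity is witnessed by reading ¬ as ∼ and ∧, ∨ as defined in
-- Tm: every axiom of L then becomes a theorem of the corresponding calculus.
--
-- Over Σ4, every formula A is given four components, for the truth of A, ¬A, □A
-- and □∼A.  Variables are contingent (□A and □∼A absurd), while a boxed formula
-- is always necessary or impossible; this validates (4), (5) and (B) at once.
-- The components live in IDM4 with the formula g to be proved playing the role
-- of falsum: ∼A is A → g, and A counts as provable when g ∨ A is.  This is a
-- classical calculus, and in it the provability of g is provability in IDM4.

module Submission where

open import Defs
open import Data.Bool using (Bool; true; false) renaming (T to IsTrue)
import Data.Bool as Bool
open import Data.Bool.Properties using (T-∧; T-≡)
open import Data.Fin using (Fin; zero; suc)
open import Data.List using (List; []; _∷_)
open import Data.Nat using (ℕ; zero; suc)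
open import Data.Product using (_×_; _,_; proj₁; proj₂)
open import Data.Unit using (⊤; tt)
open import Data.Vec using (tabulate)
open import Data.Vec.N-ary using (N-ary; _$ⁿ_)
open import Function.Bundles using (_⇔_; mk⇔; Equivalence)
open import Relation.Binary.PropositionalEquality
  using (_≡_; refl; sym; cong; cong₂; subst)

-- Hilbert calculi

record Implicational (F : Set) : Set₁ where
  infixr 5 _⊃_
  infix  2 ⊢_
  infixl 9 _∙_
  field
    _⊃_ : F → F → F
    ⊢_  : F → Set
    _∙_ : ∀ {A B} → ⊢ (A ⊃ B) → ⊢ A → ⊢ B
    k   : ∀ A B → ⊢ (A ⊃ (B ⊃ A))
    s   : ∀ A B C → ⊢ ((A ⊃ (B ⊃ C)) ⊃ ((A ⊃ B) ⊃ (A ⊃ C)))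

  infix 4 _⇛_
  -- The head of the list is the innermost antecedent, so discharging the latest hypothesis changes
  -- nothing in the derivation: the deduction theorem `lam` holds by definition.
  _⇛_ : List F → F → F
  []      ⇛ A = A
  (B ∷ Γ) ⇛ A = Γ ⇛ (B ⊃ A)

  ⇛-pure : ∀ Γ {A} → ⊢ A → ⊢ (Γ ⇛ A)
  ⇛-pure []      d = d
  ⇛-pure (B ∷ Γ) d = ⇛-pure Γ (k _ B ∙ d)

  ⇛-app : ∀ Γ {A B} → ⊢ (Γ ⇛ (A ⊃ B)) → ⊢ (Γ ⇛ A) → ⊢ (Γ ⇛ B)
  ⇛-app []      d e = d ∙ e
  ⇛-app (C ∷ Γ) d e = ⇛-app Γ (⇛-app Γ (⇛-pure Γ (s C _ _)) d) e

  -- A record, so that Γ and A can be inferred from Γ ⊩ A.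
  infix 2 _⊩_
  record _⊩_ (Γ : List F) (A : F) : Set where
    pattern; constructor ⟨_⟩
    field derivation : ⊢ (Γ ⇛ A)
  open _⊩_ public

  ⌜_⌝ : ∀ {Γ A} → ⊢ A → Γ ⊩ A
  ⌜_⌝ {Γ} d = ⟨ ⇛-pure Γ d ⟩

  infixl 9 _·_
  _·_ : ∀ {Γ A B} → Γ ⊩ (A ⊃ B) → Γ ⊩ A → Γ ⊩ B
  _·_ {Γ} ⟨ d ⟩ ⟨ e ⟩ = ⟨ ⇛-app Γ d e ⟩

  lam : ∀ {Γ A B} → A ∷ Γ ⊩ B → Γ ⊩ (A ⊃ B)
  lam ⟨ d ⟩ = ⟨ d ⟩

  weaken : ∀ {Γ A B} → Γ ⊩ A → B ∷ Γ ⊩ A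
  weaken d = ⟨ derivation (⌜ k _ _ ⌝ · d) ⟩

  h0 : ∀ {Γ A} → A ∷ Γ ⊩ A
  -- The combinator identity SKK = I.
  h0 {Γ} {A} = ⟨ ⇛-pure Γ (s A (A ⊃ A) A ∙ k A (A ⊃ A) ∙ k A A) ⟩

  h1 : ∀ {Γ A B} → B ∷ A ∷ Γ ⊩ A
  h1 = weaken h0

  h2 : ∀ {Γ A B C} → C ∷ B ∷ A ∷ Γ ⊩ A
  h2 = weaken h1

-- The negation laws are the rows of the truth tables that involve ~ and ⊃,
-- together with the elimination of an atom by case distinction.
record Negational (F : Set) : Set₁ where
  field implicational : Implicational F
  open Implicational implicational public
  infix 7 ~_
  field
    ~_     : F → F
    efq    : ∀ A B → ⊢ (~ A ⊃ (A ⊃ B))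
    dni    : ∀ A → ⊢ (A ⊃ ~ ~ A)
    refute : ∀ A B → ⊢ (A ⊃ (~ B ⊃ ~ (A ⊃ B)))
    cases  : ∀ A B → ⊢ ((A ⊃ B) ⊃ ((~ A ⊃ B) ⊃ B))

  contraposition : ∀ A B → ⊢ ((A ⊃ B) ⊃ (~ B ⊃ ~ A))
  contraposition A B = derivation {[]} (lam (lam
    (⌜ cases A (~ A) ⌝ · lam (⌜ efq B (~ A) ⌝ · h1 · (h2 · h0)) · lam h0)))

-- Stated as truth-table rows, these laws fit both primitive connectives and ones defined from `~`
-- and `⊃`.
record Classical (F : Set) : Set₁ where
  field negational : Negational F
  open Negational negational public
  infixr 6 _⊓_ _⊔_
  field
    _⊓_ _⊔_ : F → F → F
    ⊓-true   : ∀ A B → ⊢ (A ⊃ (B ⊃ (A ⊓ B)))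
    ⊓-falseˡ : ∀ A B → ⊢ (~ A ⊃ ~ (A ⊓ B))
    ⊓-falseʳ : ∀ A B → ⊢ (~ B ⊃ ~ (A ⊓ B))
    ⊔-trueˡ  : ∀ A B → ⊢ (A ⊃ (A ⊔ B))
    ⊔-trueʳ  : ∀ A B → ⊢ (B ⊃ (A ⊔ B))
    ⊔-false  : ∀ A B → ⊢ (~ A ⊃ (~ B ⊃ ~ (A ⊔ B)))

-- Classical calculi obtained from Hilbert axioms

module _ {F : Set} (I : Implicational F) where
  open Implicational I

  module _ (neg : F → F)
           (t3 : ∀ A B → ⊢ ((neg B ⊃ neg A) ⊃ ((neg B ⊃ A) ⊃ B))) where

    private
      dne : ∀ A → ⊢ (neg (neg A) ⊃ A)
      dne A = derivation {[]} (lam (⌜ t3 (neg A) A ⌝ · lam h1 · lam h0))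

    negationalFromReductio : Negational F
    negationalFromReductio = record
      { implicational = I
      ; ~_     = neg
      ; efq    = λ A B → derivation {[]} (lam (lam
          (⌜ t3 A B ⌝ · lam h2 · lam h1)))
      ; dni    = λ A → derivation {[]} (lam
          (⌜ t3 A (neg (neg A)) ⌝ · ⌜ dne (neg A) ⌝ · lam h1))
      ; refute = λ A B → derivation {[]} (lam (lam
          (⌜ t3 B (neg (A ⊃ B)) ⌝ · lam h1
            · lam (⌜ dne (A ⊃ B) ⌝ · h0 · h2))))
      -- Under `neg B`, an inner reductio yields `neg A`, because `A` would give `B`; then `neg A`
      -- gives `B`, contradicting `neg B`.
      ; cases  = λ A B → derivation {[]} (lam (lam
          (⌜ t3 B B ⌝ · lam h0
            · lam (h1 · (⌜ t3 B (neg A) ⌝ · lam h1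
                          · lam (weaken h2 · (⌜ dne A ⌝ · h0)))))))
      }

module _ {F : Set} (N : Negational F) where
  open Negational N

  classicalFromPositive :
    (_⊓_ _⊔_ : F → F → F) →
    (∀ A B → ⊢ (A ⊃ (B ⊃ (A ⊓ B)))) →
    (∀ A B → ⊢ ((A ⊓ B) ⊃ A)) →
    (∀ A B → ⊢ ((A ⊓ B) ⊃ B)) →
    (∀ A B → ⊢ (A ⊃ (A ⊔ B))) →
    (∀ A B → ⊢ (B ⊃ (A ⊔ B))) →
    (∀ A B C → ⊢ ((A ⊃ C) ⊃ ((B ⊃ C) ⊃ ((A ⊔ B) ⊃ C)))) →
    Classical F
  classicalFromPositive _⊓_ _⊔_ pair fst snd inl inr either = record
    { negational = N
    ; _⊓_ = _⊓_
    ; _⊔_ = _⊔_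
    ; ⊓-true   = pair
    ; ⊓-falseˡ = λ A B → contraposition (A ⊓ B) A ∙ fst A B
    ; ⊓-falseʳ = λ A B → contraposition (A ⊓ B) B ∙ snd A B
    ; ⊔-trueˡ  = inl
    ; ⊔-trueʳ  = inr
    -- The disjunction refutes itself: given `~ A` and `~ B`, each disjunct yields `~ (A ⊔ B)` by
    -- `efq`.
    ; ⊔-false  = λ A B → derivation {[]} (lam (lam
        (⌜ cases (A ⊔ B) (~ (A ⊔ B)) ⌝
          · (⌜ either A B (~ (A ⊔ B)) ⌝ · (⌜ efq A (~ (A ⊔ B)) ⌝ · h1)
              · (⌜ efq B (~ (A ⊔ B)) ⌝ · h0))
          · lam h0)))
    }

  classicalFromNegation : Classical F
  classicalFromNegation = record
    { negational = N
    ; _⊓_ = λ A B → ~ (A ⊃ ~ B)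
    ; _⊔_ = λ A B → ~ A ⊃ B
    ; ⊓-true   = λ A B → derivation {[]} (lam (lam
        (⌜ refute A (~ B) ⌝ · h1 · (⌜ dni B ⌝ · h0))))
    ; ⊓-falseˡ = λ A B → derivation {[]} (lam
        (⌜ dni (A ⊃ ~ B) ⌝ · (⌜ efq A (~ B) ⌝ · h0)))
    ; ⊓-falseʳ = λ A B → derivation {[]} (lam
        (⌜ dni (A ⊃ ~ B) ⌝ · lam h1))
    ; ⊔-trueˡ  = λ A B → derivation {[]} (lam (lam
        (⌜ efq A B ⌝ · h0 · h1)))
    ; ⊔-trueʳ  = λ A B → k B (~ A)
    ; ⊔-false  = λ A B → refute (~ A) B
    }

-- Kalmár's completeness argument

infixr 5 _⟶_
infixr 6 _&_ _∥_
infix  4 _⟷_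

data Schema (n : ℕ) : Set where
  atom        : Fin n → Schema n
  not         : Schema n → Schema n
  _⟶_ _&_ _∥_ : Schema n → Schema n → Schema n

_⟷_ : ∀ {n} → Schema n → Schema n → Schema n
a ⟷ b = (a ⟶ b) & (b ⟶ a)

-- Nested pairs rather than vectors: their η-law lets the instance of a schema
-- be inferred from the formula to be proved.
Env : Set → ℕ → Set
Env A zero    = ⊤
Env A (suc n) = A × Env A n

lookupEnv : ∀ {A n} → Env A n → Fin n → A
lookupEnv (a , _) zero    = a
lookupEnv (_ , v) (suc i) = lookupEnv v i

_implies_ : Bool → Bool → Bool
x implies y = Bool.not x Bool.∨ y

value : ∀ {n} → Schema n → Env Bool n → Bool
value (atom i) ρ = lookupEnv ρ i
value (not a)  ρ = Bool.not (value a ρ)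
value (a ⟶ b)  ρ = value a ρ implies value b ρ
value (a & b)  ρ = value a ρ Bool.∧ value b ρ
value (a ∥ b)  ρ = value a ρ Bool.∨ value b ρ

holdsEverywhere : ∀ n → (Env Bool n → Bool) → Bool
holdsEverywhere zero    f = f tt
holdsEverywhere (suc n) f =
  holdsEverywhere n (λ ρ → f (true , ρ)) Bool.∧ holdsEverywhere n (λ ρ → f (false , ρ))

holdsAt : ∀ n (f : Env Bool n → Bool) → IsTrue (holdsEverywhere n f) →
          ∀ ρ → f ρ ≡ true
holdsAt zero    f t tt          = Equivalence.to T-≡ t
holdsAt (suc n) f t (true  , ρ) = holdsAt n _ (proj₁ (Equivalence.to T-∧ t)) ρ
holdsAt (suc n) f t (false , ρ) =
  holdsAt n _ (proj₂ (Equivalence.to (T-∧ {holdsEverywhere n _}) t)) ρ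

module Tautologies {F : Set} (C : Classical F) where
  open Classical C

  ⟦_⟧ : ∀ {n} → Schema n → Env F n → F
  ⟦ atom i ⟧ v = lookupEnv v i
  ⟦ not a ⟧  v = ~ ⟦ a ⟧ v
  ⟦ a ⟶ b ⟧  v = ⟦ a ⟧ v ⊃ ⟦ b ⟧ v
  ⟦ a & b ⟧  v = ⟦ a ⟧ v ⊓ ⟦ b ⟧ v
  ⟦ a ∥ b ⟧  v = ⟦ a ⟧ v ⊔ ⟦ b ⟧ v

  literal : Bool → F → F
  literal true  A = A
  literal false A = ~ A

  literals : ∀ {n} → Env Bool n → Env F n → List F
  literals {zero}  _       _       = []
  literals {suc n} (x , ρ) (A , v) = literal x A ∷ literals ρ v

  atom-row : ∀ {n} (i : Fin n) ρ v →
             literals ρ v ⊩ literal (lookupEnv ρ i) (lookupEnv v i)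
  atom-row zero    ρ v = h0
  atom-row (suc i) ρ v = weaken (atom-row i (proj₂ ρ) (proj₂ v))

  not-row : ∀ x A → ⊢ (literal x A ⊃ literal (Bool.not x) (~ A))
  not-row true  A = dni A
  not-row false A = derivation {[]} (lam h0)

  ⟶-row : ∀ x y A B → ⊢ (literal x A ⊃ (literal y B ⊃ literal (x implies y) (A ⊃ B)))
  ⟶-row true  true  A B = derivation {[]} (lam (lam (lam h1)))
  ⟶-row true  false A B = refute A B
  ⟶-row false y     A B = derivation {[]} (lam (lam (⌜ efq A B ⌝ · h1)))

  &-row : ∀ x y A B → ⊢ (literal x A ⊃ (literal y B ⊃ literal (x Bool.∧ y) (A ⊓ B)))
  &-row true  true  A B = ⊓-true A B
  &-row true  false A B = derivation {[]} (lam (lam (⌜ ⊓-falseʳ A B ⌝ · h0)))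
  &-row false y     A B = derivation {[]} (lam (lam (⌜ ⊓-falseˡ A B ⌝ · h1)))

  ∥-row : ∀ x y A B → ⊢ (literal x A ⊃ (literal y B ⊃ literal (x Bool.∨ y) (A ⊔ B)))
  ∥-row true  y     A B = derivation {[]} (lam (lam (⌜ ⊔-trueˡ A B ⌝ · h1)))
  ∥-row false true  A B = derivation {[]} (lam (lam (⌜ ⊔-trueʳ A B ⌝ · h0)))
  ∥-row false false A B = ⊔-false A B

  -- Induction on the schema; the row lemmas combine the signed subschemas exactly as `value`
  -- combines their truth values.
  kalmár : ∀ {n} (a : Schema n) ρ v → literals ρ v ⊩ literal (value a ρ) (⟦ a ⟧ v)
  kalmár (atom i) ρ v = atom-row i ρ v
  kalmár (not a)  ρ v = ⌜ not-row (value a ρ) _ ⌝ · kalmár a ρ v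
  kalmár (a ⟶ b)  ρ v =
    ⌜ ⟶-row (value a ρ) (value b ρ) _ _ ⌝ · kalmár a ρ v · kalmár b ρ v
  kalmár (a & b)  ρ v =
    ⌜ &-row (value a ρ) (value b ρ) _ _ ⌝ · kalmár a ρ v · kalmár b ρ v
  kalmár (a ∥ b)  ρ v =
    ⌜ ∥-row (value a ρ) (value b ρ) _ _ ⌝ · kalmár a ρ v · kalmár b ρ v

  -- The head atom is available with either sign over the same remaining literals, so `cases`
  -- eliminates it.
  dischargeLiterals : ∀ n (v : Env F n) {A} → (∀ ρ → literals ρ v ⊩ A) → ⊢ A
  dischargeLiterals zero    v       d = derivation (d tt)
  dischargeLiterals (suc n) (B , v) d = dischargeLiterals n v λ ρ →
    ⌜ cases B _ ⌝ · lam (d (true , ρ)) · lam (d (false , ρ))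

  -- For a concrete tautology the truth-table check computes to the unit type, so Agda fills it in
  -- by itself. Validity makes every signed instance the schema itself, which leaves only the
  -- literals to discharge.
  taut : ∀ n (a : N-ary n (Schema n) (Schema n)) →
         let a′ = a $ⁿ tabulate atom in
         {_ : IsTrue (holdsEverywhere n (value a′))} → {v : Env F n} → ⊢ ⟦ a′ ⟧ v
  taut n a {t} {v} = dischargeLiterals n v λ ρ →
    subst (λ x → literals ρ v ⊩ literal x _) (holdsAt n _ t ρ)
          (kalmár (a $ⁿ tabulate atom) ρ v)

-- Four-component models of IvFDE

module Model {F : Set} (C : Classical F) (pos neg : ℕ → F) where
  open Classical C
  open Tautologies C

  absurd : F → F
  absurd A = ~ (A ⊃ A)

  holds fails nec imposs : Fm → F

  holds (var i) = pos i
  holds (a ∧ b) = holds a ⊓ holds b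
  holds (a ∨ b) = holds a ⊔ holds b
  holds (a ⇒ b) = holds a ⊃ holds b
  holds (¬ a)   = fails a
  holds (∼ a)   = ~ holds a
  holds (□ a)   = nec a

  fails (var i) = neg i
  fails (a ∧ b) = fails a ⊔ fails b
  fails (a ∨ b) = fails a ⊓ fails b
  fails (a ⇒ b) = holds a ⊓ fails b
  fails (¬ a)   = holds a
  -- Chosen so that `imposs⇒fails` and `nec⇒¬fails` pass through `∼`: necessity of `a` must entail
  -- this value and impossibility of `a` must refute it.
  fails (∼ a)   = holds a
  fails (□ a)   = ~ nec a

  nec (var i) = absurd (pos i)
  nec (a ∧ b) = nec a ⊓ nec b
  nec (a ∨ b) = nec a ⊔ nec b
  -- This makes M1 an identity and turns K and K1 into disjunctive syllogisms.
  nec (a ⇒ b) = imposs a ⊔ nec b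
  nec (¬ a)   = imposs a
  nec (∼ a)   = imposs a
  nec (□ a)   = nec a

  imposs (var i) = absurd (pos i)
  imposs (a ∧ b) = imposs a ⊔ imposs b
  imposs (a ∨ b) = imposs a ⊓ imposs b
  imposs (a ⇒ b) = nec a ⊓ imposs b
  imposs (¬ a)   = nec a
  imposs (∼ a)   = nec a
  -- Hence `∼ □ ∼ □ a` receives the double negation of `nec a`, which gives (5) and, through
  -- `nec⇒holds`, (B).
  imposs (□ a)   = ~ nec a

  -- Simultaneous induction: this is (T), and together with `imposs⇒¬holds` it gives `consistent`.
  -- The two bounds on `fails` are carried along because `¬` exchanges `holds` with `fails` and
  -- `nec` with `imposs`. At variables all four hold vacuously.
  nec⇒holds      : ∀ a → ⊢ (nec a ⊃ holds a)
  nec⇒¬fails     : ∀ a → ⊢ (nec a ⊃ ~ fails a)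
  imposs⇒fails   : ∀ a → ⊢ (imposs a ⊃ fails a)
  imposs⇒¬holds  : ∀ a → ⊢ (imposs a ⊃ ~ holds a)

  nec⇒holds (var i) = taut 2 (λ a b → not (a ⟶ a) ⟶ b)
  nec⇒holds (a ∧ b) =
    taut 4 (λ a b c d → (a ⟶ c) ⟶ (b ⟶ d) ⟶ (a & b ⟶ c & d)) ∙ nec⇒holds a ∙ nec⇒holds b
  nec⇒holds (a ∨ b) =
    taut 4 (λ a b c d → (a ⟶ c) ⟶ (b ⟶ d) ⟶ (a ∥ b ⟶ c ∥ d)) ∙ nec⇒holds a ∙ nec⇒holds b
  nec⇒holds (a ⇒ b) =
    taut 4 (λ a b c d → (a ⟶ not c) ⟶ (b ⟶ d) ⟶ (a ∥ b ⟶ c ⟶ d))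
      ∙ imposs⇒¬holds a ∙ nec⇒holds b
  nec⇒holds (¬ a)   = imposs⇒fails a
  nec⇒holds (∼ a)   = imposs⇒¬holds a
  nec⇒holds (□ a)   = taut 1 (λ a → a ⟶ a)

  nec⇒¬fails (var i) = taut 2 (λ a b → not (a ⟶ a) ⟶ b)
  nec⇒¬fails (a ∧ b) =
    taut 4 (λ a b c d → (a ⟶ not c) ⟶ (b ⟶ not d) ⟶ (a & b ⟶ not (c ∥ d)))
      ∙ nec⇒¬fails a ∙ nec⇒¬fails b
  nec⇒¬fails (a ∨ b) =
    taut 4 (λ a b c d → (a ⟶ not c) ⟶ (b ⟶ not d) ⟶ (a ∥ b ⟶ not (c & d)))
      ∙ nec⇒¬fails a ∙ nec⇒¬fails b
  nec⇒¬fails (a ⇒ b) =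
    taut 4 (λ a b c d → (a ⟶ not c) ⟶ (b ⟶ not d) ⟶ (a ∥ b ⟶ not (c & d)))
      ∙ imposs⇒¬holds a ∙ nec⇒¬fails b
  nec⇒¬fails (¬ a)   = imposs⇒¬holds a
  nec⇒¬fails (∼ a)   = imposs⇒¬holds a
  nec⇒¬fails (□ a)   = taut 1 (λ a → a ⟶ not (not a))

  imposs⇒fails (var i) = taut 2 (λ a b → not (a ⟶ a) ⟶ b)
  imposs⇒fails (a ∧ b) =
    taut 4 (λ a b c d → (a ⟶ c) ⟶ (b ⟶ d) ⟶ (a ∥ b ⟶ c ∥ d))
      ∙ imposs⇒fails a ∙ imposs⇒fails b
  imposs⇒fails (a ∨ b) =
    taut 4 (λ a b c d → (a ⟶ c) ⟶ (b ⟶ d) ⟶ (a & b ⟶ c & d))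
      ∙ imposs⇒fails a ∙ imposs⇒fails b
  imposs⇒fails (a ⇒ b) =
    taut 4 (λ a b c d → (a ⟶ c) ⟶ (b ⟶ d) ⟶ (a & b ⟶ c & d))
      ∙ nec⇒holds a ∙ imposs⇒fails b
  imposs⇒fails (¬ a)   = nec⇒holds a
  imposs⇒fails (∼ a)   = nec⇒holds a
  imposs⇒fails (□ a)   = taut 1 (λ a → a ⟶ a)

  imposs⇒¬holds (var i) = taut 2 (λ a b → not (a ⟶ a) ⟶ b)
  imposs⇒¬holds (a ∧ b) =
    taut 4 (λ a b c d → (a ⟶ not c) ⟶ (b ⟶ not d) ⟶ (a ∥ b ⟶ not (c & d)))
      ∙ imposs⇒¬holds a ∙ imposs⇒¬holds b
  imposs⇒¬holds (a ∨ b) =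
    taut 4 (λ a b c d → (a ⟶ not c) ⟶ (b ⟶ not d) ⟶ (a & b ⟶ not (c ∥ d)))
      ∙ imposs⇒¬holds a ∙ imposs⇒¬holds b
  imposs⇒¬holds (a ⇒ b) =
    taut 4 (λ a b c d → (a ⟶ c) ⟶ (b ⟶ not d) ⟶ (a & b ⟶ not (c ⟶ d)))
      ∙ nec⇒holds a ∙ imposs⇒¬holds b
  imposs⇒¬holds (¬ a)   = nec⇒¬fails a
  imposs⇒¬holds (∼ a)   =
    taut 2 (λ a b → (a ⟶ b) ⟶ (a ⟶ not (not b))) ∙ nec⇒holds a
  imposs⇒¬holds (□ a)   = taut 1 (λ a → a ⟶ a)

  -- Excludes one disjunct in the syllogisms behind K, K1 and `i7` to `i10`.
  consistent : ∀ a → ⊢ ~ (nec a ⊓ imposs a)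
  consistent a = taut 3 (λ n i h → (n ⟶ h) ⟶ (i ⟶ not h) ⟶ not (n & i))
    ∙ nec⇒holds a ∙ imposs⇒¬holds a

  ⊢iff-refl : ∀ {A} → ⊢ ((A ⊃ A) ⊓ (A ⊃ A))
  ⊢iff-refl = taut 1 (λ a → a ⟷ a)

  ⊢id : ∀ {A} → ⊢ (A ⊃ A)
  ⊢id = taut 1 (λ a → a ⟶ a)

  sound-idm : ∀ {a} → IDMAx SΣ4 a → ⊢ holds a
  sound-idm (a1 a b)   = taut 2 (λ a b → a ⟶ b ⟶ a)
  sound-idm (a2 a b c) = taut 3 (λ a b c → (a ⟶ b ⟶ c) ⟶ (a ⟶ b) ⟶ a ⟶ c)
  sound-idm (a3 a b)   = taut 2 (λ a b → a ⟶ b ⟶ a & b)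
  sound-idm (a4 a b)   = taut 2 (λ a b → a & b ⟶ a)
  sound-idm (a5 a b)   = taut 2 (λ a b → a & b ⟶ b)
  sound-idm (a6 a b)   = taut 2 (λ a b → a ⟶ a ∥ b)
  sound-idm (a7 a b)   = taut 2 (λ a b → b ⟶ a ∥ b)
  sound-idm (a8 a b c) = taut 3 (λ a b c → (a ⟶ c) ⟶ (b ⟶ c) ⟶ a ∥ b ⟶ c)
  -- The clauses of `fails` copy these four negation axioms, so both sides are literally the same
  -- formula.
  sound-idm (a9 a)     = ⊢iff-refl
  sound-idm (a10 a b)  = ⊢iff-refl
  sound-idm (a11 a b)  = ⊢iff-refl
  sound-idm (a12 a b)  = ⊢iff-refl
  sound-idm (a13 a b)  = taut 2 (λ a b → a ∥ (a ⟶ b))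

  sound-tm : ∀ {a} → TmAx SΣm a → ⊢ holds a
  sound-tm (t1 a b)   = taut 2 (λ a b → a ⟶ b ⟶ a)
  sound-tm (t2 a b c) = taut 3 (λ a b c → (a ⟶ b ⟶ c) ⟶ (a ⟶ b) ⟶ a ⟶ c)
  sound-tm (t3 a b)   = taut 2 (λ a b → (not b ⟶ not a) ⟶ (not b ⟶ a) ⟶ b)
  sound-tm (K a b)    =
    taut 3 (λ n i n′ → not (n & i) ⟶ i ∥ n′ ⟶ n ⟶ n′) ∙ consistent a
  sound-tm (K1 a b)   =
    taut 3 (λ n i i′ → not (n & i) ⟶ i′ ∥ n ⟶ i ⟶ i′) ∙ consistent b
  sound-tm (K2 a b)   = ⊢iff-refl
  sound-tm (M1 a b)   = ⊢id
  sound-tm (T a)      = nec⇒holds a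
  sound-tm (DN1 a)    = ⊢iff-refl

  sound-iv : ∀ {a} → IvAx a → ⊢ holds a
  sound-iv (i1 a b)  = ⊢iff-refl
  sound-iv (i2 a b)  = ⊢iff-refl
  sound-iv (i3 a b)  = ⊢id
  sound-iv (i4 a b)  = ⊢id
  sound-iv (i5 a)    = ⊢iff-refl
  sound-iv (i6 a)    = ⊢iff-refl
  sound-iv (i7 a b)  =
    taut 3 (λ n i i′ → not (n & i) ⟶ i ∥ i′ ⟶ n ⟶ i′) ∙ consistent a
  sound-iv (i8 a b)  =
    taut 3 (λ n i i′ → not (n & i) ⟶ i′ ∥ i ⟶ n ⟶ i′) ∙ consistent b
  sound-iv (i9 a b)  =
    taut 3 (λ n i n′ → not (n & i) ⟶ n ∥ n′ ⟶ i ⟶ n′) ∙ consistent a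
  sound-iv (i10 a b) =
    taut 3 (λ n i n′ → not (n & i) ⟶ n′ ∥ n ⟶ i ⟶ n′) ∙ consistent b

  sound-modal : ∀ {e a} → ModalAx SΣm e a → ⊢ holds a
  sound-modal (ax4 _ a) = ⊢id
  sound-modal (ax5 _ a) = taut 1 (λ n → not (not n) ⟶ n)
  sound-modal (axB _ a) =
    taut 2 (λ n h → (n ⟶ h) ⟶ not (not n) ⟶ h) ∙ nec⇒holds a

  sound : ∀ {e Γ a} → (∀ {b} → Γ b → ⊢ holds b) → Γ ⊢Iv[ e ] a → ⊢ holds a
  sound γ (hyp x)        = γ x
  sound γ (ax (idm x))   = sound-idm x
  sound γ (ax (tm x))    = sound-tm x
  sound γ (ax (iv x))    = sound-iv x
  sound γ (ax (modal x)) = sound-modal x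
  sound γ (mp d e)       = sound γ e ∙ sound γ d

-- Conservativity over IDM4

module IDM4 (Γ : Fm4 → Set) (g : Fm4) where

  plain : Implicational Fm4
  plain = record
    { _⊃_ = imp4
    ; ⊢_  = λ A → Γ ⊢IDM4 A
    ; _∙_ = λ d e → mp e d
    ; k   = λ A B → ax (a1 A B)
    ; s   = λ A B C → ax (a2 A B C)
    }

  open Implicational plain

  or-map : ∀ A B → ⊢ ((A ⊃ B) ⊃ (or4 g A ⊃ or4 g B))
  or-map A B = derivation {[]} (lam
    (⌜ ax (a8 g A (or4 g B)) ⌝ · ⌜ ax (a6 g B) ⌝ · lam (⌜ ax (a7 g B) ⌝ · (h1 · h0))))

  modG-app : ∀ {A B} → ⊢ or4 g (A ⊃ B) → ⊢ or4 g A → ⊢ or4 g B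
  modG-app {A} {B} d e =
    ax (a8 g (A ⊃ B) (or4 g B)) ∙ ax (a6 g B)
      ∙ derivation {[]} (lam (⌜ or-map A B ⌝ · h0 · ⌜ e ⌝)) ∙ d

  inject : ∀ {A} → ⊢ A → ⊢ or4 g A
  inject d = ax (a7 g _) ∙ d

  modG : Classical Fm4
  modG = classicalFromPositive negational and4 or4
    (λ A B → inject (ax (a3 A B)))
    (λ A B → inject (ax (a4 A B)))
    (λ A B → inject (ax (a5 A B)))
    (λ A B → inject (ax (a6 A B)))
    (λ A B → inject (ax (a7 A B)))
    (λ A B C → inject (ax (a8 A B C)))
    where
    negational : Negational Fm4
    negational = record
      { implicational = record
          { _⊃_ = imp4
          ; ⊢_  = λ A → Γ ⊢IDM4 or4 g A
          ; _∙_ = modG-app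
          ; k   = λ A B → inject (ax (a1 A B))
          ; s   = λ A B C → inject (ax (a2 A B C))
          }
      ; ~_     = λ A → A ⊃ g
      -- Ex falso comes from the instance `g ∨ (g → B)` of `a13`, by weakening its right disjunct.
      ; efq    = λ A B → or-map (g ⊃ B) _
          ∙ derivation {[]} (lam (lam (lam (h2 · (h1 · h0))))) ∙ ax (a13 g B)
      ; dni    = λ A → inject (derivation {[]} (lam (lam (h0 · h1))))
      ; refute = λ A B → inject (derivation {[]} (lam (lam (lam (h1 · (h0 · h2))))))
      -- Excluded middle for the negation `A → g` is again an instance of `a13`.
      ; cases  = λ A B → inject (derivation {[]} (lam (lam
          (⌜ ax (a8 A (A ⊃ g) B) ⌝ · h1 · h0 · ⌜ ax (a13 A g) ⌝))))
      }

  fromModG : ⊢ or4 g g → ⊢ g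
  fromModG d = ax (a8 g g g) ∙ derivation {[]} (lam h0) ∙ derivation {[]} (lam h0) ∙ d

  module G = Classical modG
  open Tautologies modG
  -- A variable and its `neg4` stand for themselves as unrelated components, since IDM4 allows both
  -- or neither to hold.
  open Model modG var4 (λ i → neg4 (var4 i)) public

  iff4 : Fm4 → Fm4 → Fm4
  iff4 = IDMSig.iff S4

  -- Negation in IDM4 does not respect provable equivalence, so negated formulas get their own
  -- simultaneous induction, in which `a9` to `a12` push the negation inward.
  holds-ι4 : ∀ a → G.⊢ iff4 (holds (ι4 a)) a
  fails-ι4 : ∀ a → G.⊢ iff4 (fails (ι4 a)) (neg4 a)

  holds-ι4 (var4 i)   = ⊢iff-refl
  holds-ι4 (and4 a b) =
    taut 4 (λ a a′ b b′ → (a ⟷ a′) ⟶ (b ⟷ b′) ⟶ (a & b ⟷ a′ & b′))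
      G.∙ holds-ι4 a G.∙ holds-ι4 b
  holds-ι4 (or4 a b)  =
    taut 4 (λ a a′ b b′ → (a ⟷ a′) ⟶ (b ⟷ b′) ⟶ (a ∥ b ⟷ a′ ∥ b′))
      G.∙ holds-ι4 a G.∙ holds-ι4 b
  holds-ι4 (imp4 a b) =
    taut 4 (λ a a′ b b′ → (a ⟷ a′) ⟶ (b ⟷ b′) ⟶ ((a ⟶ b) ⟷ (a′ ⟶ b′)))
      G.∙ holds-ι4 a G.∙ holds-ι4 b
  holds-ι4 (neg4 a)   = fails-ι4 a

  fails-ι4 (var4 i)   = ⊢iff-refl
  fails-ι4 (and4 a b) =
    taut 5 (λ a a′ b b′ c → (a ⟷ a′) ⟶ (b ⟷ b′) ⟶ (c ⟷ a′ ∥ b′) ⟶ (a ∥ b ⟷ c))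
      G.∙ fails-ι4 a G.∙ fails-ι4 b G.∙ inject (ax (a11 a b))
  fails-ι4 (or4 a b)  =
    taut 5 (λ a a′ b b′ c → (a ⟷ a′) ⟶ (b ⟷ b′) ⟶ (c ⟷ a′ & b′) ⟶ (a & b ⟷ c))
      G.∙ fails-ι4 a G.∙ fails-ι4 b G.∙ inject (ax (a10 a b))
  fails-ι4 (imp4 a b) =
    taut 5 (λ a a′ b b′ c → (a ⟷ a′) ⟶ (b ⟷ b′) ⟶ (c ⟷ a′ & b′) ⟶ (a & b ⟷ c))
      G.∙ holds-ι4 a G.∙ fails-ι4 b G.∙ inject (ax (a12 a b))
  fails-ι4 (neg4 a)   =
    taut 3 (λ a a′ c → (a ⟷ a′) ⟶ (c ⟷ a′) ⟶ (a ⟷ c))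
      G.∙ holds-ι4 a G.∙ inject (ax (a9 a))

  conservative : ∀ {e} → Img ι4 Γ ⊢Iv[ e ] ι4 g → Γ ⊢IDM4 g
  -- Soundness derives `holds (ι4 g)`, hence `g`, in the calculus modulo `g`; that is a derivation
  -- of `g ∨ g`.
  conservative d = fromModG
    (taut 2 (λ a b → (a ⟷ b) ⟶ a ⟶ b) G.∙ holds-ι4 g
      G.∙ sound (λ { (a , γ , refl) →
            taut 2 (λ a b → (a ⟷ b) ⟶ b ⟶ a) G.∙ holds-ι4 a G.∙ inject (hyp γ) }) d)

ι4-idm : ∀ {a} → IDMAx S4 a → IDMAx SΣ4 (ι4 a)
ι4-idm (a1 a b)   = a1 (ι4 a) (ι4 b)
ι4-idm (a2 a b c) = a2 (ι4 a) (ι4 b) (ι4 c)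
ι4-idm (a3 a b)   = a3 (ι4 a) (ι4 b)
ι4-idm (a4 a b)   = a4 (ι4 a) (ι4 b)
ι4-idm (a5 a b)   = a5 (ι4 a) (ι4 b)
ι4-idm (a6 a b)   = a6 (ι4 a) (ι4 b)
ι4-idm (a7 a b)   = a7 (ι4 a) (ι4 b)
ι4-idm (a8 a b c) = a8 (ι4 a) (ι4 b) (ι4 c)
ι4-idm (a9 a)     = a9 (ι4 a)
ι4-idm (a10 a b)  = a10 (ι4 a) (ι4 b)
ι4-idm (a11 a b)  = a11 (ι4 a) (ι4 b)
ι4-idm (a12 a b)  = a12 (ι4 a) (ι4 b)
ι4-idm (a13 a b)  = a13 (ι4 a) (ι4 b)

ι4-deriv : ∀ {e Γ a} → Γ ⊢IDM4 a → Img ι4 Γ ⊢Iv[ e ] ι4 a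
ι4-deriv (hyp γ)  = hyp (_ , γ , refl)
ι4-deriv (ax x)   = ax (idm (ι4-idm x))
ι4-deriv (mp d e) = mp (ι4-deriv d) (ι4-deriv e)

-- Conservativity over Tm

collapse : Fm → FmM
collapse (var i) = varM i
collapse (a ∧ b) = TmSig.and Sm (collapse a) (collapse b)
collapse (a ∨ b) = TmSig.or Sm (collapse a) (collapse b)
collapse (a ⇒ b) = impM (collapse a) (collapse b)
collapse (¬ a)   = tnM (collapse a)
collapse (∼ a)   = tnM (collapse a)
collapse (□ a)   = boxM (collapse a)

collapse-ιm : ∀ a → collapse (ιm a) ≡ a
collapse-ιm (varM i)   = refl
collapse-ιm (impM a b) = cong₂ impM (collapse-ιm a) (collapse-ιm b)
collapse-ιm (tnM a)    = cong tnM (collapse-ιm a)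
collapse-ιm (boxM a)   = cong boxM (collapse-ιm a)

module Tm (e : Ext) (Γ : FmM → Set) where

  classical : Classical FmM
  classical = classicalFromNegation (negationalFromReductio
    (record
      { _⊃_ = impM
      ; ⊢_  = λ A → Γ ⊢Tm[ e ] A
      ; _∙_ = λ d e → mp e d
      ; k   = λ A B → ax (base (t1 A B))
      ; s   = λ A B C → ax (base (t2 A B C))
      })
    tnM (λ A B → ax (base (t3 A B))))

  open Classical classical
  open Tautologies classical

  ⊢iff-refl : ∀ {A} → ⊢ TmSig.iff Sm A A
  ⊢iff-refl = taut 1 (λ a → a ⟷ a)

  axiom : ∀ {A} → TmAx Sm A → ⊢ A
  axiom x = ax (base x)

  collapse-idm : ∀ {a} → IDMAx SΣ4 a → ⊢ collapse a
  collapse-idm (a1 a b)   = taut 2 (λ a b → a ⟶ b ⟶ a)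
  collapse-idm (a2 a b c) = taut 3 (λ a b c → (a ⟶ b ⟶ c) ⟶ (a ⟶ b) ⟶ a ⟶ c)
  collapse-idm (a3 a b)   = taut 2 (λ a b → a ⟶ b ⟶ a & b)
  collapse-idm (a4 a b)   = taut 2 (λ a b → a & b ⟶ a)
  collapse-idm (a5 a b)   = taut 2 (λ a b → a & b ⟶ b)
  collapse-idm (a6 a b)   = taut 2 (λ a b → a ⟶ a ∥ b)
  collapse-idm (a7 a b)   = taut 2 (λ a b → b ⟶ a ∥ b)
  collapse-idm (a8 a b c) = taut 3 (λ a b c → (a ⟶ c) ⟶ (b ⟶ c) ⟶ a ∥ b ⟶ c)
  collapse-idm (a9 a)     = taut 1 (λ a → not (not a) ⟷ a)
  collapse-idm (a10 a b)  = taut 2 (λ a b → not (a ∥ b) ⟷ not a & not b)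
  collapse-idm (a11 a b)  = taut 2 (λ a b → not (a & b) ⟷ not a ∥ not b)
  collapse-idm (a12 a b)  = taut 2 (λ a b → not (a ⟶ b) ⟷ a & not b)
  collapse-idm (a13 a b)  = taut 2 (λ a b → a ∥ (a ⟶ b))

  collapse-tm : ∀ {a} → TmAx SΣm a → TmAx Sm (collapse a)
  collapse-tm (t1 a b)   = t1 (collapse a) (collapse b)
  collapse-tm (t2 a b c) = t2 (collapse a) (collapse b) (collapse c)
  collapse-tm (t3 a b)   = t3 (collapse a) (collapse b)
  collapse-tm (K a b)    = K (collapse a) (collapse b)
  collapse-tm (K1 a b)   = K1 (collapse a) (collapse b)
  collapse-tm (K2 a b)   = K2 (collapse a) (collapse b)
  collapse-tm (M1 a b)   = M1 (collapse a) (collapse b)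
  collapse-tm (T a)      = T (collapse a)
  collapse-tm (DN1 a)    = DN1 (collapse a)

  -- The defined conjunction is a negated implication, so this is K2 with consequent `tnM B`, whose
  -- double negation under the box DN1 removes.
  □-and : ∀ A B → ⊢ TmSig.iff Sm (boxM (TmSig.and Sm A B)) (TmSig.and Sm (boxM A) (boxM B))
  □-and A B =
    taut 4 (λ ab a b b″ → (ab ⟷ a & b″) ⟶ (b ⟷ b″) ⟶ (ab ⟷ a & b))
      ∙ axiom (K2 A (tnM B)) ∙ axiom (DN1 B)

  -- Unfolded, the schemas are instances of K, K1, K2, M1 and DN1 for implications with a negated
  -- side. Modus ponens being the only rule, equivalents cannot be exchanged freely under the box,
  -- so each boxed double negation is moved by an explicit DN1.
  collapse-iv : ∀ {a} → IvAx a → ⊢ collapse a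
  collapse-iv (i1 a b) = □-and (collapse a) (collapse b)
  collapse-iv (i2 a b) =
    taut 4 (λ o a b c → (o ⟷ a & b) ⟶ (c ⟷ a & b) ⟶ (o ⟷ c))
      ∙ axiom (K2 (tnM A) B) ∙ □-and (tnM A) (tnM B)
    where A = collapse a; B = collapse b
  collapse-iv (i3 a b) =
    taut 4 (λ a b c c″ → (a ∥ b ⟶ c) ⟶ (c ⟷ c″) ⟶ (a ∥ b ⟶ c″))
      ∙ axiom (M1 A (tnM B)) ∙ axiom (DN1 (impM A (tnM B)))
    where A = collapse a; B = collapse b
  collapse-iv (i4 a b) =
    taut 4 (λ a a″ b c → (a″ ∥ b ⟶ c) ⟶ (a ⟷ a″) ⟶ (a ∥ b ⟶ c))
      ∙ axiom (M1 (tnM A) B) ∙ axiom (DN1 A)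
    where A = collapse a; B = collapse b
  collapse-iv (i5 a) = axiom (DN1 (collapse a))
  collapse-iv (i6 a) = axiom (DN1 (tnM (collapse a)))
  collapse-iv (i7 a b) =
    taut 4 (λ c c″ a b → (c ⟷ c″) ⟶ (c ⟶ a ⟶ b) ⟶ c″ ⟶ a ⟶ b)
      ∙ axiom (DN1 (impM A (tnM B))) ∙ axiom (K A (tnM B))
    where A = collapse a; B = collapse b
  collapse-iv (i8 a b) =
    taut 5 (λ c c″ b b″ a →
        (c ⟷ c″) ⟶ (b ⟷ b″) ⟶ (c ⟶ b″ ⟶ a) ⟶ c″ ⟶ b ⟶ a)
      ∙ axiom (DN1 (impM A (tnM B))) ∙ axiom (DN1 B) ∙ axiom (K1 A (tnM B))
    where A = collapse a; B = collapse b
  collapse-iv (i9 a b) = axiom (K (tnM (collapse a)) (collapse b))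
  collapse-iv (i10 a b) =
    taut 4 (λ c b a a″ → (c ⟶ b ⟶ a″) ⟶ (a ⟷ a″) ⟶ c ⟶ b ⟶ a)
      ∙ axiom (K1 (tnM A) B) ∙ axiom (DN1 A)
    where A = collapse a; B = collapse b

  collapse-modal : ∀ {a} → ModalAx SΣm e a → ModalAx Sm e (collapse a)
  collapse-modal (ax4 h a) = ax4 h (collapse a)
  collapse-modal (ax5 h a) = ax5 h (collapse a)
  collapse-modal (axB h a) = axB h (collapse a)

  collapse-deriv : ∀ {a} → Img ιm Γ ⊢Iv[ e ] a → ⊢ collapse a
  collapse-deriv (hyp (a , γ , refl)) = subst ⊢_ (sym (collapse-ιm a)) (hyp γ)
  collapse-deriv (ax (idm x))         = collapse-idm x
  collapse-deriv (ax (tm x))          = axiom (collapse-tm x)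
  collapse-deriv (ax (iv x))          = collapse-iv x
  collapse-deriv (ax (modal x))       = ax (modal (collapse-modal x))
  collapse-deriv (mp d e)             = mp (collapse-deriv d) (collapse-deriv e)

  -- `collapse` is a retraction of `ιm`, so the collapsed derivation ends in the original formula.
  conservative : ∀ {a} → Img ιm Γ ⊢Iv[ e ] ιm a → ⊢ a
  conservative {a} d = subst ⊢_ (collapse-ιm a) (collapse-deriv d)

-- The defined ∧ and ∨ of Tm occur in its axioms only outside □, so replacing
-- them by the primitive connectives needs propositional reasoning only.
module Iv (e : Ext) (Γ : Fm → Set) where

  classical : Classical Fm
  classical = classicalFromPositive
    (negationalFromReductio
      (record
        { _⊃_ = _⇒_
        ; ⊢_  = λ A → Γ ⊢Iv[ e ] A
        ; _∙_ = λ d e → mp e d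
        ; k   = λ A B → ax (tm (t1 A B))
        ; s   = λ A B C → ax (tm (t2 A B C))
        })
      ∼_ (λ A B → ax (tm (t3 A B))))
    _∧_ _∨_
    (λ A B → ax (idm (a3 A B)))
    (λ A B → ax (idm (a4 A B)))
    (λ A B → ax (idm (a5 A B)))
    (λ A B → ax (idm (a6 A B)))
    (λ A B → ax (idm (a7 A B)))
    (λ A B C → ax (idm (a8 A B C)))

  open Classical classical
  open Tautologies classical

  ιm-tm : ∀ {a} → TmAx Sm a → ⊢ ιm a
  ιm-tm (t1 a b)   = ax (tm (t1 (ιm a) (ιm b)))
  ιm-tm (t2 a b c) = ax (tm (t2 (ιm a) (ιm b) (ιm c)))
  ιm-tm (t3 a b)   = ax (tm (t3 (ιm a) (ιm b)))
  ιm-tm (K a b)    = ax (tm (K (ιm a) (ιm b)))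
  ιm-tm (K1 a b)   = ax (tm (K1 (ιm a) (ιm b)))
  ιm-tm (K2 a b)   =
    -- The conclusion spells out the defined equivalence and conjunction of Tm; the premise uses the
    -- primitive ones.
    taut 3 (λ c a b → (c ⟷ a & b) ⟶
        not ((c ⟶ not (a ⟶ not b)) ⟶ not (not (a ⟶ not b) ⟶ c)))
      ∙ ax (tm (K2 (ιm a) (ιm b)))
  ιm-tm (M1 a b)   =
    taut 3 (λ a b c → (a ∥ b ⟶ c) ⟶ (not a ⟶ b) ⟶ c) ∙ ax (tm (M1 (ιm a) (ιm b)))
  ιm-tm (T a)      = ax (tm (T (ιm a)))
  ιm-tm (DN1 a)    =
    taut 2 (λ a b → (a ⟷ b) ⟶ not ((a ⟶ b) ⟶ not (b ⟶ a))) ∙ ax (tm (DN1 (ιm a)))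

ιm-modal : ∀ {e a} → ModalAx Sm e a → ModalAx SΣm e (ιm a)
ιm-modal (ax4 h a) = ax4 h (ιm a)
ιm-modal (ax5 h a) = ax5 h (ιm a)
ιm-modal (axB h a) = axB h (ιm a)

ιm-deriv : ∀ {e Γ a} → Γ ⊢Tm[ e ] a → Img ιm Γ ⊢Iv[ e ] ιm a
ιm-deriv (hyp γ)        = hyp (_ , γ , refl)
ιm-deriv {e} {Γ} (ax (base x)) = Iv.ιm-tm e (Img ιm Γ) x
ιm-deriv (ax (modal x)) = ax (modal (ιm-modal x))
ιm-deriv (mp d e)       = mp (ιm-deriv d) (ιm-deriv e)

mainTheorem12 : (L : Ext) →
    ((Γ : Fm4 → Set) (φ : Fm4) → (Img ι4 Γ ⊢Iv[ L ] ι4 φ) ⇔ (Γ ⊢IDM4 φ))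
    × ((Γ : FmM → Set) (φ : FmM) → (Img ιm Γ ⊢Iv[ L ] ιm φ) ⇔ (Γ ⊢Tm[ L ] φ))
mainTheorem12 L =
    (λ Γ φ → mk⇔ (IDM4.conservative Γ φ) ι4-deriv)
  , (λ Γ φ → mk⇔ (Tm.conservative L Γ) ιm-deriv)
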